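{- The class of Whitehead groups is first-order definable in a diagrammatic way in the category $Ab$ of abelian groups (over ZFC). That is, there is a diagrammatic first-order formula $\varphi(X)$ in the language of categories, with one free object variable, such that ZFC proves: for every abelian group $A$, $\varphi(A)$ holds in the category $Ab$ if and only if $A$ is a Whitehead group.
   Context: An abelian group $A$ is a Whitehead group if every extension of $A$ by $\mathbb{Z}$ splits, i.e. for each short exact sequence $0\to\mathbb{Z}\to E\to A\to0$ of abelian groups there is a homomorphism $A\to E$ that is a right inverse (section) of $E\to A$; equivalently $\mathrm{Ext}(A,\mathbb{Z})=0$. $Ab$ is the category of abelian groups and homomorphisms. The first-order language of categories speaks about objects, morphisms, and composition. Diagrammatic (in the sense of Freyd) means expressible by a finite formula in a language of diagrams using the quantifiers $\forall,\exists$: variables range over objects and over morphisms with declared source and target, atomic formulas are equalities between parallel morphisms (commutativity of diagrams, with composites and identities allowed), formulas are closed under Boolean connectives and quantifiers over objects and over morphisms with given source and target, and equality between objects is not used. -}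

module Defs where

open import Level using (Level; Lift; Setω; _⊔_) renaming (suc to lsuc)
open import Algebra.Bundles using (AbelianGroup)
open import Algebra.Morphism.Bundles using (GroupHomomorphism)
import Algebra.Morphism.Construct.Composition as Composition
import Algebra.Morphism.Construct.Identity as Identity
open import Data.Fin.Base using (Fin; suc)
open import Data.Integer.Properties using (+-0-abelianGroup)
open import Data.List.Base using (List; []; _∷_; map)
open import Data.List.Membership.Propositional using (_∈_)
open import Data.List.Relation.Unary.All as All using (All; []; _∷_)
open import Data.List.Relation.Unary.All.Properties using (map⁺)
open import Data.Nat.Base as ℕ using (ℕ)
open import Data.Product.Base using (∃; _×_; _,_)
open import Data.Sum.Base using (_⊎_)
open import Data.Vec.Functional as Vector using (Vector)
open import Function.Bundles using (_⇔_)
open import Function.Definitions using (Injective; Surjective)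
open import Relation.Binary.Structures using (IsEquivalence)
open import Relation.Nullary.Negation.Core using (¬_)

private variable
  a b c ℓ₁ ℓ₂ ℓ₃ : Level

-- Hom-sets are setoids: parallel morphisms have an equality, objects do not.
record Category (o ℓ e : Level) : Set (lsuc (o ⊔ ℓ ⊔ e)) where
  infix  4 _⇒_ _≈_
  infixr 9 _∘_
  field
    Obj       : Set o
    _⇒_       : Obj → Obj → Set ℓ
    _≈_       : {A B : Obj} → A ⇒ B → A ⇒ B → Set e
    id        : {A : Obj} → A ⇒ A
    _∘_       : {A B C : Obj} → B ⇒ C → A ⇒ B → A ⇒ C
    equiv     : {A B : Obj} → IsEquivalence (_≈_ {A} {B})
    ∘-resp-≈  : {A B C : Obj} {f f′ : B ⇒ C} {g g′ : A ⇒ B} →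
                f ≈ f′ → g ≈ g′ → f ∘ g ≈ f′ ∘ g′
    assoc     : {A B C D : Obj} {f : A ⇒ B} {g : B ⇒ C} {h : C ⇒ D} →
                (h ∘ g) ∘ f ≈ h ∘ (g ∘ f)
    identityˡ : {A B : Obj} {f : A ⇒ B} → id ∘ f ≈ f
    identityʳ : {A B : Obj} {f : A ⇒ B} → f ∘ id ≈ f

-- A morphism variable is declared with its source and target, which are
-- among the n object variables in scope.
MorphismContext : ℕ → Set
MorphismContext n = List (Fin n × Fin n)

-- Bringing a new object variable (number zero) into scope renumbers the
-- old ones.
shift : ∀ {n} → Fin n × Fin n → Fin (ℕ.suc n) × Fin (ℕ.suc n)
shift (x , y) = suc x , suc y

infixr 9 _∘ₜ_
infix  6 _≐_
infix  5 ¬ᶠ_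
infixr 4 _∧ᶠ_
infixr 3 _∨ᶠ_
infixr 2 _⇒ᶠ_

data Term {n : ℕ} (Γ : MorphismContext n) : Fin n → Fin n → Set where
  var  : ∀ {x y} → (x , y) ∈ Γ → Term Γ x y
  idₜ  : ∀ {x} → Term Γ x x
  _∘ₜ_ : ∀ {x y z} → Term Γ y z → Term Γ x y → Term Γ x z

data Formula {n : ℕ} (Γ : MorphismContext n) : Set where
  _≐_            : ∀ {x y} → Term Γ x y → Term Γ x y → Formula Γ
  ¬ᶠ_            : Formula Γ → Formula Γ
  _∧ᶠ_ _∨ᶠ_ _⇒ᶠ_ : Formula Γ → Formula Γ → Formula Γ
  ∀Obj ∃Obj      : Formula (map shift Γ) → Formula Γ
  ∀Mor ∃Mor      : (x y : Fin n) → Formula ((x , y) ∷ Γ) → Formula Γ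

-- One free object variable and no free morphism variables.
ObjectFormula : Set
ObjectFormula = Formula {1} []

module Semantics {o ℓ e : Level} (𝒞 : Category o ℓ e) where
  open Category 𝒞

  private variable
    n : ℕ
    Γ : MorphismContext n
    x y : Fin n

  MorphismEnv : Vector Obj n → MorphismContext n → Set ℓ
  MorphismEnv ρ Γ = All (λ (x , y) → ρ x ⇒ ρ y) Γ

  ⟦_⟧ₜ : Term Γ x y → (ρ : Vector Obj n) → MorphismEnv ρ Γ → ρ x ⇒ ρ y
  ⟦ var i  ⟧ₜ ρ σ = All.lookup σ i
  ⟦ idₜ    ⟧ₜ ρ σ = id
  ⟦ t ∘ₜ u ⟧ₜ ρ σ = ⟦ t ⟧ₜ ρ σ ∘ ⟦ u ⟧ₜ ρ σ

  ⟦_⟧ : {Γ : MorphismContext n} → Formula Γ →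
        (ρ : Vector Obj n) → MorphismEnv ρ Γ → Set (o ⊔ ℓ ⊔ e)
  ⟦ t ≐ u      ⟧ ρ σ = Lift (o ⊔ ℓ) (⟦ t ⟧ₜ ρ σ ≈ ⟦ u ⟧ₜ ρ σ)
  ⟦ ¬ᶠ φ       ⟧ ρ σ = ¬ ⟦ φ ⟧ ρ σ
  ⟦ φ ∧ᶠ ψ     ⟧ ρ σ = ⟦ φ ⟧ ρ σ × ⟦ ψ ⟧ ρ σ
  ⟦ φ ∨ᶠ ψ     ⟧ ρ σ = ⟦ φ ⟧ ρ σ ⊎ ⟦ ψ ⟧ ρ σ
  ⟦ φ ⇒ᶠ ψ     ⟧ ρ σ = ⟦ φ ⟧ ρ σ → ⟦ ψ ⟧ ρ σ
  ⟦ ∀Obj φ     ⟧ ρ σ = ∀ X → ⟦ φ ⟧ (X Vector.∷ ρ) (map⁺ σ)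
  ⟦ ∃Obj φ     ⟧ ρ σ = ∃ λ X → ⟦ φ ⟧ (X Vector.∷ ρ) (map⁺ σ)
  ⟦ ∀Mor x y φ ⟧ ρ σ = (f : ρ x ⇒ ρ y) → ⟦ φ ⟧ ρ (f ∷ σ)
  ⟦ ∃Mor x y φ ⟧ ρ σ = ∃ λ (f : ρ x ⇒ ρ y) → ⟦ φ ⟧ ρ (f ∷ σ)

infix 4 _⊨_[_]

_⊨_[_] : ∀ {o ℓ e} (𝒞 : Category o ℓ e) →
         ObjectFormula → Category.Obj 𝒞 → Set (o ⊔ ℓ ⊔ e)
𝒞 ⊨ φ [ X ] = Semantics.⟦_⟧ 𝒞 φ (X Vector.∷ Vector.[]) []

Hom : AbelianGroup a ℓ₁ → AbelianGroup b ℓ₂ → Set (a ⊔ b ⊔ ℓ₁ ⊔ ℓ₂)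
Hom A B = GroupHomomorphism (AbelianGroup.rawGroup A) (AbelianGroup.rawGroup B)

open GroupHomomorphism using (⟦_⟧; ⟦⟧-cong; isGroupHomomorphism)

Ab : (ℓ : Level) → Category (lsuc ℓ) ℓ ℓ
Ab ℓ = record
  { Obj       = AbelianGroup ℓ ℓ
  ; _⇒_       = Hom
  ; _≈_       = λ {A} {B} f g → ∀ x → AbelianGroup._≈_ B (⟦ f ⟧ x) (⟦ g ⟧ x)
  ; id        = λ {A} → record
    { isGroupHomomorphism =
        Identity.isGroupHomomorphism (AbelianGroup.rawGroup A) (AbelianGroup.refl A) }
  ; _∘_       = λ {A} {B} {C} g f → record
    { isGroupHomomorphism =
        Composition.isGroupHomomorphism (AbelianGroup.trans C)
          (isGroupHomomorphism f) (isGroupHomomorphism g) }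
  ; equiv     = λ {A} {B} → let open AbelianGroup B in record
    { refl  = λ x → refl
    ; sym   = λ p x → sym (p x)
    ; trans = λ p q x → trans (p x) (q x)
    }
  ; ∘-resp-≈  = λ {A} {B} {C} {f} {f′} {g} {g′} p q x →
                  AbelianGroup.trans C (⟦⟧-cong f (q x)) (p (⟦ g′ ⟧ x))
  ; assoc     = λ {A} {B} {C} {D} x → AbelianGroup.refl D
  ; identityˡ = λ {A} {B} x → AbelianGroup.refl B
  ; identityʳ = λ {A} {B} x → AbelianGroup.refl B
  }

record IsShortExact {K : AbelianGroup a ℓ₁} {E : AbelianGroup b ℓ₂}
                    {A : AbelianGroup c ℓ₃} (i : Hom K E) (p : Hom E A)
                    : Set (a ⊔ b ⊔ c ⊔ ℓ₁ ⊔ ℓ₂ ⊔ ℓ₃) where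
  private
    module K = AbelianGroup K
    module E = AbelianGroup E
    module A = AbelianGroup A
  field
    injective  : Injective K._≈_ E._≈_ ⟦ i ⟧
    exact      : ∀ x → ⟦ p ⟧ x A.≈ A.ε ⇔ ∃ λ k → ⟦ i ⟧ k E.≈ x
    surjective : Surjective E._≈_ A._≈_ ⟦ p ⟧

Splits : {E : AbelianGroup a ℓ₁} {A : AbelianGroup b ℓ₂} →
         Hom E A → Set (a ⊔ b ⊔ ℓ₁ ⊔ ℓ₂)
Splits {E = E} {A = A} p =
  ∃ λ (s : Hom A E) → ∀ x → AbelianGroup._≈_ A (⟦ p ⟧ (⟦ s ⟧ x)) x

-- E ranges over the universe of A; ℤ is the level-zero group of integers.
IsWhitehead : ∀ {ℓ} → AbelianGroup ℓ ℓ → Set (lsuc ℓ)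
IsWhitehead {ℓ} A =
  (E : AbelianGroup ℓ ℓ) (i : Hom +-0-abelianGroup E) (p : Hom E A) →
  IsShortExact {K = +-0-abelianGroup} {E} {A} i p → Splits {E = E} {A} p

-- Σ for a property in Setω, so that one witness serves all universe levels.
record Σω (A : Set a) (B : A → Setω) : Setω where
  constructor _,ω_
  field
    witness  : A
    property : B witness

{-# OPTIONS --safe #-}

-- The group ℤ is, up to isomorphism, the only separator of Ab that is a
-- retract of every separator: a separator H has a nonzero homomorphism to ℤ,
-- which after division by the positive generator of its image has a section;
-- and the nonzero retracts of ℤ are isomorphic to ℤ.  Since the elements of
-- a group are the morphisms from ℤ, short exactness of ℤ → E → A and
-- splitting then become conditions on morphisms from an object so described.

module Submission where

open import Defs
open import Level using (Level; Lift; lift; lower; 0ℓ; _⊔_)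
open import Algebra.Bundles using (AbelianGroup; RawGroup)
open import Algebra.Morphism.Bundles using (GroupHomomorphism)
import Algebra.Morphism.Construct.Composition as Composition
open import Algebra.Morphism.GroupMonomorphism using (isAbelianGroup)
import Algebra.Properties.AbelianGroup as AbelianGroupProperties
import Algebra.Properties.CommutativeSemigroup as CommutativeSemigroupProperties
import Algebra.Properties.Monoid.Mult as Mult
open import Axiom.ExcludedMiddle using (ExcludedMiddle)
open import Data.Fin.Base using (Fin; suc)
open import Data.Fin.Patterns using (0F; 1F; 2F)
open import Data.Integer.Base as ℤ using (ℤ; +_; -[1+_]; 0ℤ; 1ℤ; _⊖_)
open import Data.Integer.DivMod using (_/ℕ_; _%ℕ_; a≡a%ℕn+[a/ℕn]*n; n%ℕd<d)
import Data.Integer.Properties as ℤ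
open import Data.List.Base using ([]; _∷_)
open import Data.List.Relation.Unary.All using ([]; _∷_)
open import Data.List.Relation.Unary.Any using (here; there)
open import Data.Nat.Base as ℕ using (zero; suc)
open import Data.Nat.Induction using (<-rec)
import Data.Nat.Properties as ℕ
open import Data.Product.Base using (∃; ∃₂; _,_)
import Data.Vec.Functional as Vector
open import Function.Bundles using (_⇔_; mk⇔; Equivalence)
open import Relation.Binary.PropositionalEquality as ≡
  using (_≡_; _≢_; cong; module ≡-Reasoning)
import Relation.Binary.Reasoning.Setoid as ≈-Reasoning
open import Relation.Nullary.Decidable.Core using (yes; no)
open import Relation.Nullary.Negation.Core using (contradiction)

open GroupHomomorphism
  using (⟦_⟧; ⟦⟧-cong; homo; ε-homo; ⁻¹-homo; isGroupHomomorphism)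

-- Homomorphisms of abelian groups

ℤ⁺ : AbelianGroup 0ℓ 0ℓ
ℤ⁺ = ℤ.+-0-abelianGroup

module _ {a ℓ₁ b ℓ₂} (A : AbelianGroup a ℓ₁) (B : AbelianGroup b ℓ₂) where
  private
    module A = AbelianGroup A
    module B = AbelianGroup B

  homomorphism : (f : A.Carrier → B.Carrier) →
    (∀ {x y} → x A.≈ y → f x B.≈ f y) →
    (∀ x y → f (x A.∙ y) B.≈ f x B.∙ f y) → Hom A B
  homomorphism f f-cong f-homo = record
    { ⟦_⟧ = f
    ; isGroupHomomorphism = record
      { isMonoidHomomorphism = record
        { isMagmaHomomorphism = record
          { isRelHomomorphism = record { cong = f-cong }
          ; homo = f-homo
          }
        ; ε-homo = f-ε
        }
      ; ⁻¹-homo = λ x → BP.inverseˡ-unique _ _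
          (B.trans (B.sym (f-homo _ _)) (B.trans (f-cong (A.inverseˡ x)) f-ε))
      }
    }
    where
    module BP = AbelianGroupProperties B
    f-ε : f A.ε B.≈ B.ε
    f-ε = BP.identityʳ-unique _ _ (B.trans (B.sym (f-homo _ _)) (f-cong (A.identityˡ A.ε)))

compose : ∀ {a ℓ₁ b ℓ₂ c ℓ₃} (A : AbelianGroup a ℓ₁) (B : AbelianGroup b ℓ₂)
  (C : AbelianGroup c ℓ₃) → Hom B C → Hom A B → Hom A C
compose A B C g f = record
  { isGroupHomomorphism = Composition.isGroupHomomorphism (AbelianGroup.trans C)
      (isGroupHomomorphism f) (isGroupHomomorphism g) }

idHom : ∀ {a ℓ} (A : AbelianGroup a ℓ) → Hom A A
idHom A = homomorphism A A (λ x → x) (λ x≈y → x≈y) (λ _ _ → AbelianGroup.refl A)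

zeroHom : ∀ {a ℓ₁ b ℓ₂} (A : AbelianGroup a ℓ₁) (B : AbelianGroup b ℓ₂) → Hom A B
zeroHom A B = homomorphism A B (λ _ → ε) (λ _ → refl) (λ _ _ → sym (identityˡ ε))
  where open AbelianGroup B

-- Integer multiples

module Multiples {a ℓ} (G : AbelianGroup a ℓ) where
  open AbelianGroup G
  open AbelianGroupProperties G
  open CommutativeSemigroupProperties commutativeSemigroup using (interchange)
  open Mult monoid using (×-congʳ; ×-homo-+) renaming (_×_ to _×ₙ_)
  open ≈-Reasoning setoid

  infixr 8 _·_

  _·_ : ℤ → Carrier → Carrier
  (+ n)    · x = n ×ₙ x
  -[1+ n ] · x = (suc n ×ₙ x) ⁻¹

  ·-congʳ : ∀ n {x y} → x ≈ y → n · x ≈ n · y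
  ·-congʳ (+ n)    x≈y = ×-congʳ n x≈y
  ·-congʳ -[1+ n ] x≈y = ⁻¹-cong (×-congʳ (suc n) x≈y)

  ·-congˡ : ∀ {m n x} → m ≡ n → m · x ≈ n · x
  ·-congˡ ≡.refl = refl

  1·x≈x : ∀ x → 1ℤ · x ≈ x
  1·x≈x = identityʳ

  -- Integer addition with opposite signs computes to `⊖`, so this supplies the mixed cases of
  -- `·-homo-+`. In the last clause a copy of `x - x` absorbs the common successor.
  ·-homo-⊖ : ∀ m n x → (m ⊖ n) · x ≈ m ×ₙ x - n ×ₙ x
  ·-homo-⊖ zero    zero    x = sym (inverseʳ ε)
  ·-homo-⊖ zero    (suc n) x = sym (identityˡ _)
  ·-homo-⊖ (suc m) zero    x = sym (trans (∙-congˡ ε⁻¹≈ε) (identityʳ _))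
  ·-homo-⊖ (suc m) (suc n) x = begin
    (suc m ⊖ suc n) · x                 ≈⟨ ·-congˡ (ℤ.[1+m]⊖[1+n]≡m⊖n m n) ⟩
    (m ⊖ n) · x                         ≈⟨ ·-homo-⊖ m n x ⟩
    m ×ₙ x - n ×ₙ x                     ≈⟨ identityˡ _ ⟨
    ε ∙ (m ×ₙ x - n ×ₙ x)               ≈⟨ ∙-congʳ (inverseʳ x) ⟨
    (x - x) ∙ (m ×ₙ x - n ×ₙ x)         ≈⟨ interchange _ _ _ _ ⟩
    (x ∙ m ×ₙ x) ∙ (x ⁻¹ ∙ (n ×ₙ x) ⁻¹) ≈⟨ ∙-congˡ (⁻¹-∙-comm _ _) ⟩
    suc m ×ₙ x - suc n ×ₙ x             ∎

  ·-homo-+ : ∀ m n x → (m ℤ.+ n) · x ≈ m · x ∙ n · x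
  ·-homo-+ (+ m)    (+ n)    x = ×-homo-+ x m n
  ·-homo-+ (+ m)    -[1+ n ] x = ·-homo-⊖ m (suc n) x
  ·-homo-+ -[1+ m ] (+ n)    x = trans (·-homo-⊖ n (suc m) x) (comm _ _)
  ·-homo-+ -[1+ m ] -[1+ n ] x = begin
    (suc (suc (m ℕ.+ n)) ×ₙ x) ⁻¹         ≡⟨ cong (λ k → (k ×ₙ x) ⁻¹) (ℕ.+-suc (suc m) n) ⟨
    ((suc m ℕ.+ suc n) ×ₙ x) ⁻¹           ≈⟨ ⁻¹-cong (×-homo-+ x (suc m) (suc n)) ⟩
    (suc m ×ₙ x ∙ suc n ×ₙ x) ⁻¹          ≈⟨ ⁻¹-∙-comm _ _ ⟨
    (suc m ×ₙ x) ⁻¹ ∙ (suc n ×ₙ x) ⁻¹     ∎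

  multiples : Carrier → Hom ℤ⁺ G
  multiples x = homomorphism ℤ⁺ G (_· x) ·-congˡ (λ m n → ·-homo-+ m n x)

module _ {a ℓ₁ b ℓ₂} (A : AbelianGroup a ℓ₁) (B : AbelianGroup b ℓ₂) where
  private
    module A where
      open AbelianGroup A public
      open Multiples A public
      open Mult monoid public using () renaming (_×_ to _×ₙ_)
    module B where
      open AbelianGroup B public
      open Multiples B public
      open Mult monoid public using () renaming (_×_ to _×ₙ_)

  ·-homo : (f : Hom A B) → ∀ n x → ⟦ f ⟧ (n A.· x) B.≈ n B.· ⟦ f ⟧ x
  ·-homo f (+ n) x = ×-homo n
    where
    ×-homo : ∀ n → ⟦ f ⟧ (n A.×ₙ x) B.≈ n B.×ₙ ⟦ f ⟧ x
    ×-homo zero    = ε-homo f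
    ×-homo (suc n) = B.trans (homo f _ _) (B.∙-congˡ (×-homo n))
  ·-homo f -[1+ n ] x = B.trans (⁻¹-homo f _) (B.⁻¹-cong (·-homo f (+ suc n) x))

-- This opens the ring laws, cancellation above all, to the values of integer-valued homomorphisms.
·≡* : ∀ m n → Multiples._·_ ℤ⁺ m n ≡ m ℤ.* n
·≡* m n = go m
  where
  open Multiples ℤ⁺

  go-+ : ∀ k → (+ k) · n ≡ + k ℤ.* n
  go-+ zero    = ≡.refl
  go-+ (suc k) = ≡.trans (cong (λ l → n ℤ.+ l) (go-+ k)) (≡.sym (ℤ.suc-* (+ k) n))

  go : ∀ m → m · n ≡ m ℤ.* n
  go (+ k)    = go-+ k
  go -[1+ k ] = ≡.trans (cong ℤ.-_ (go-+ (suc k))) (ℤ.neg-distribˡ-* (+ suc k) n)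

module _ {a ℓ} (G : AbelianGroup a ℓ) where
  open AbelianGroup G
  open Multiples G

  n·ε≈ε : ∀ n → n · ε ≈ ε
  n·ε≈ε n = sym (·-homo G G (zeroHom G G) n ε)

  hom-ℤ-· : (f : Hom ℤ⁺ G) → ∀ n → ⟦ f ⟧ n ≈ n · ⟦ f ⟧ 1ℤ
  hom-ℤ-· f n = trans
    (⟦⟧-cong f (≡.sym (≡.trans (·≡* n 1ℤ) (ℤ.*-identityʳ n))))
    (·-homo ℤ⁺ G f n 1ℤ)

-- Infinite cyclic groups

-- An explicit isomorphism with the integers: `coordinate` is inverse to taking multiples of
-- `generator`. In this form `Z` may live in any universe.
record InfiniteCyclic {a ℓ} (Z : AbelianGroup a ℓ) : Set (a ⊔ ℓ) where
  private module Z = AbelianGroup Z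
  open Z using (Carrier; _≈_)
  open Multiples Z
  field
    generator       : Carrier
    coordinate      : Hom Z ℤ⁺
    coordinate-one  : ⟦ coordinate ⟧ generator ≡ 1ℤ
    generates       : ∀ z → ⟦ coordinate ⟧ z · generator ≈ z

  coordinate-· : ∀ n → ⟦ coordinate ⟧ (n · generator) ≡ n
  coordinate-· n = begin
    ⟦ coordinate ⟧ (n · generator)     ≡⟨ ·-homo Z ℤ⁺ coordinate n generator ⟩
    n ·ℤ ⟦ coordinate ⟧ generator      ≡⟨ cong (n ·ℤ_) coordinate-one ⟩
    n ·ℤ 1ℤ                            ≡⟨ ·≡* n 1ℤ ⟩
    n ℤ.* 1ℤ                           ≡⟨ ℤ.*-identityʳ n ⟩
    n                                  ∎
    where
    open ≡-Reasoning
    open Multiples ℤ⁺ renaming (_·_ to _·ℤ_)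

  coordinate-injective : ∀ {x y} → ⟦ coordinate ⟧ x ≡ ⟦ coordinate ⟧ y → x ≈ y
  coordinate-injective {x} {y} eq =
    Z.trans (Z.sym (generates x)) (Z.trans (·-congˡ eq) (generates y))

  module _ {b ℓ′} (G : AbelianGroup b ℓ′) where
    private
      module G where
        open AbelianGroup G public
        open Multiples G public

    -- `Z` is free on `generator`, so homomorphisms from `Z` stand for elements of `G`; this one
    -- stands for `x`.
    point : G.Carrier → Hom Z G
    point x = compose Z ℤ⁺ G (G.multiples x) coordinate

    point-generator : ∀ x → ⟦ point x ⟧ generator G.≈ x
    point-generator x = G.trans (G.·-congˡ coordinate-one) (G.1·x≈x x)

    hom-· : (f : Hom Z G) → ∀ z → ⟦ f ⟧ z G.≈ ⟦ coordinate ⟧ z G.· ⟦ f ⟧ generator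
    hom-· f z = G.trans (⟦⟧-cong f (Z.sym (generates z)))
      (·-homo Z G f (⟦ coordinate ⟧ z) generator)

-- The integers in an arbitrary universe

module _ (ℓ : Level) where
  private
    rawGroup : RawGroup ℓ ℓ
    rawGroup = record
      { Carrier = Lift ℓ ℤ
      ; _≈_     = λ m n → Lift ℓ (lower m ≡ lower n)
      ; _∙_     = λ m n → lift (lower m ℤ.+ lower n)
      ; ε       = lift 0ℤ
      ; _⁻¹     = λ m → lift (ℤ.- lower m)
      }

  Liftℤ : AbelianGroup ℓ ℓ
  Liftℤ = record
    { RawGroup rawGroup
    -- The group laws are pulled back along the injective map `lower`.
    ; isAbelianGroup = isAbelianGroup {G₁ = rawGroup} {G₂ = AbelianGroup.rawGroup ℤ⁺} {⟦_⟧ = lower}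
        record
          { isGroupHomomorphism = record
            { isMonoidHomomorphism = record
              { isMagmaHomomorphism = record
                { isRelHomomorphism = record { cong = lower }
                ; homo = λ _ _ → ≡.refl
                }
              ; ε-homo = ≡.refl
              }
            ; ⁻¹-homo = λ _ → ≡.refl
            }
          ; injective = lift
          }
        ℤ.+-0-isAbelianGroup
    }

  lowerHom : Hom Liftℤ ℤ⁺
  lowerHom = homomorphism Liftℤ ℤ⁺ lower lower (λ _ _ → ≡.refl)

  liftHom : Hom ℤ⁺ Liftℤ
  liftHom = homomorphism ℤ⁺ Liftℤ lift lift (λ _ _ → lift ≡.refl)

  Liftℤ-infiniteCyclic : InfiniteCyclic Liftℤ
  Liftℤ-infiniteCyclic = record
    { generator      = lift 1ℤ
    ; coordinate     = lowerHom
    ; coordinate-one = ≡.refl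
    ; generates      = λ z → AbelianGroup.sym Liftℤ (hom-ℤ-· Liftℤ liftHom (lower z))
    }

-- Formulas

var₀ : ∀ {n} {x y : Fin n} {Γ} → Term ((x , y) ∷ Γ) x y
var₀ = var (here ≡.refl)

var₁ : ∀ {n} {x y : Fin n} {f Γ} → Term (f ∷ (x , y) ∷ Γ) x y
var₁ = var (there (here ≡.refl))

var₂ : ∀ {n} {x y : Fin n} {f g Γ} → Term (f ∷ g ∷ (x , y) ∷ Γ) x y
var₂ = var (there (there (here ≡.refl)))

var₃ : ∀ {n} {x y : Fin n} {f g h Γ} → Term (f ∷ g ∷ h ∷ (x , y) ∷ Γ) x y
var₃ = var (there (there (there (here ≡.refl))))

module _ {n} {Γ : MorphismContext n} where

  -- The parallel pair runs from object `1F` to object `0F`, and `h` is renumbered past both. The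
  -- pair is `var₂`, `var₁` under the innermost quantifier but `var₁`, `var₀` in the conclusion.
  separator : Fin n → Formula Γ
  separator h =
    ∀Obj (∀Obj (∀Mor 1F 0F (∀Mor 1F 0F
      (∀Mor (suc (suc h)) 1F (var₂ ∘ₜ var₀ ≐ var₁ ∘ₜ var₀) ⇒ᶠ var₁ ≐ var₀))))

module _ {n} {Γ : MorphismContext n} where

  universalRetract : Fin n → Formula Γ
  universalRetract z =
    ∀Obj (separator 0F ⇒ᶠ ∃Mor (suc z) 0F (∃Mor 0F (suc z) (var₀ ∘ₜ var₁ ≐ idₜ)))

  integers : Fin n → Formula Γ
  integers z = separator z ∧ᶠ universalRetract z

module _ {n} {Γ : MorphismContext n} (z e a : Fin n) where

  -- The morphisms from z play the role of elements; that such a morphism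
  -- vanishes is expressed by saying that all its composites with
  -- endomorphisms of z are equal.
  shortExact : Formula ((e , a) ∷ (z , e) ∷ Γ)
  shortExact =
    ∀Mor z z (∀Mor z z (var₃ ∘ₜ var₁ ≐ var₃ ∘ₜ var₀ ⇒ᶠ var₁ ≐ var₀))
    ∧ᶠ ∀Mor z z (∀Mor z z (var₂ ∘ₜ var₃ ∘ₜ var₁ ≐ var₂ ∘ₜ var₃ ∘ₜ var₀))
    ∧ᶠ ∀Mor z e
         (∀Mor z z (∀Mor z z (var₃ ∘ₜ var₂ ∘ₜ var₁ ≐ var₃ ∘ₜ var₂ ∘ₜ var₀))
          ⇒ᶠ ∃Mor z z (var₃ ∘ₜ var₀ ≐ var₁))
    ∧ᶠ ∀Mor z a (∃Mor z e (var₂ ∘ₜ var₀ ≐ var₁))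

  split : Formula ((e , a) ∷ (z , e) ∷ Γ)
  split = ∃Mor a e (var₁ ∘ₜ var₀ ≐ idₜ)

-- Objects `0F`, `1F`, `2F` are the extension, a copy of the integers and the free variable. As the
-- copy is bound universally, one direction needs a copy to exist, the other needs every copy to be
-- infinite cyclic.
whitehead : ObjectFormula
whitehead =
  ∀Obj (integers 0F ⇒ᶠ
    ∀Obj (∀Mor 1F 0F (∀Mor 0F 2F (shortExact 1F 0F 2F ⇒ᶠ split 1F 0F 2F))))

-- The integers among the separators

-- Each element `x` is the value of `point X x` at the generator, so morphisms that agree after
-- composition with it agree at `x`.
infiniteCyclic⇒separator : ∀ {ℓ} (Z : AbelianGroup ℓ ℓ) → InfiniteCyclic Z →
  Ab ℓ ⊨ separator 0F [ Z ]
infiniteCyclic⇒separator Z cyc X Y f g eq = lift λ x → begin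
  ⟦ f ⟧ x                          ≈⟨ ⟦⟧-cong f (point-generator X x) ⟨
  ⟦ f ⟧ (⟦ point X x ⟧ generator)  ≈⟨ lower (eq (point X x)) generator ⟩
  ⟦ g ⟧ (⟦ point X x ⟧ generator)  ≈⟨ ⟦⟧-cong g (point-generator X x) ⟩
  ⟦ g ⟧ x                          ∎
  where
  open InfiniteCyclic cyc
  open ≈-Reasoning (AbelianGroup.setoid Y)

-- Equivalently, the integers are a retract of `H`: sending 1 to `h` gives a section of `f`.
HasUnitValue : ∀ {a ℓ} → AbelianGroup a ℓ → Set (a ⊔ ℓ)
HasUnitValue H = ∃₂ λ (f : Hom H ℤ⁺) h → ⟦ f ⟧ h ≡ 1ℤ

module _ (em : ∀ {a} → ExcludedMiddle a) where

  -- The value d is lowered by Euclidean division until it divides all values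
  -- of the homomorphism, which can then be divided by d.
  positive⇒hasUnitValue : ∀ {a ℓ} (H : AbelianGroup a ℓ) (f : Hom H ℤ⁺) →
    ∀ d h → ⟦ f ⟧ h ≡ + suc d → HasUnitValue H
  positive⇒hasUnitValue H f = <-rec _ step
    where
    open AbelianGroup H
    open Multiples H

    step : ∀ d →
      (∀ {c} → c ℕ.< d → ∀ h → ⟦ f ⟧ h ≡ + suc c → HasUnitValue H) →
      ∀ h → ⟦ f ⟧ h ≡ + suc d → HasUnitValue H
    step d rec h fh≡D with em {P = ∃₂ λ x c → ⟦ f ⟧ x %ℕ suc d ≡ suc c}
    ... | yes (x , c , r≡1+c) = rec c<d (x - q · h) (begin
      ⟦ f ⟧ (x - q · h)                ≡⟨ homo f _ _ ⟩
      ⟦ f ⟧ x ℤ.+ ⟦ f ⟧ ((q · h) ⁻¹)   ≡⟨ cong (λ k → ⟦ f ⟧ x ℤ.+ k) (⁻¹-homo f _) ⟩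
      ⟦ f ⟧ x ℤ.- ⟦ f ⟧ (q · h)        ≡⟨ cong (λ k → ⟦ f ⟧ x ℤ.- k) f[qh]≡qD ⟩
      ⟦ f ⟧ x ℤ.- q ℤ.* D              ≡⟨ cong (ℤ._- q ℤ.* D) (a≡a%ℕn+[a/ℕn]*n (⟦ f ⟧ x) (suc d)) ⟩
      + r ℤ.+ q ℤ.* D ℤ.- q ℤ.* D      ≡⟨ //-rightDividesʳ (q ℤ.* D) (+ r) ⟩
      + r                              ≡⟨ cong +_ r≡1+c ⟩
      + suc c                          ∎)
      where
      open ≡-Reasoning
      open AbelianGroupProperties ℤ⁺ using (//-rightDividesʳ)
      D = + suc d
      r = ⟦ f ⟧ x %ℕ suc d
      q = ⟦ f ⟧ x /ℕ suc d

      -- `d` and `c` are one less than the positive value and the nonzero remainder.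
      c<d : c ℕ.< d
      c<d = ℕ.s<s⁻¹ (≡.subst (ℕ._< suc d) r≡1+c (n%ℕd<d (⟦ f ⟧ x) (suc d)))

      f[qh]≡qD : ⟦ f ⟧ (q · h) ≡ q ℤ.* D
      f[qh]≡qD = ≡.trans (·-homo H ℤ⁺ f q h) (≡.trans (·≡* q _) (cong (q ℤ.*_) fh≡D))
    -- All remainders vanish, so the quotients by `D` form a homomorphism; at `h`, where the value
    -- is `D`, the quotient is 1.
    ... | no ¬r = g , h , ℤ.*-cancelʳ-≡ _ _ D
        (≡.trans (≡.sym (f≡q*D h)) (≡.trans fh≡D (≡.sym (ℤ.*-identityˡ D))))
      where
      D = + suc d

      q : Carrier → ℤ
      q x = ⟦ f ⟧ x /ℕ suc d

      f≡q*D : ∀ x → ⟦ f ⟧ x ≡ q x ℤ.* D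
      f≡q*D x with ⟦ f ⟧ x %ℕ suc d in r≡ | a≡a%ℕn+[a/ℕn]*n (⟦ f ⟧ x) (suc d)
      ... | zero  | eq = ≡.trans eq (ℤ.+-identityˡ _)
      ... | suc c | _  = contradiction (x , c , r≡) ¬r

      g : Hom H ℤ⁺
      g = homomorphism H ℤ⁺ q (λ x≈y → cong (_/ℕ suc d) (⟦⟧-cong f x≈y)) λ x y →
        ℤ.*-cancelʳ-≡ _ _ D (begin
          q (x ∙ y) ℤ.* D            ≡⟨ f≡q*D (x ∙ y) ⟨
          ⟦ f ⟧ (x ∙ y)              ≡⟨ homo f x y ⟩
          ⟦ f ⟧ x ℤ.+ ⟦ f ⟧ y        ≡⟨ ≡.cong₂ ℤ._+_ (f≡q*D x) (f≡q*D y) ⟩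
          q x ℤ.* D ℤ.+ q y ℤ.* D    ≡⟨ ℤ.*-distribʳ-+ D (q x) (q y) ⟨
          (q x ℤ.+ q y) ℤ.* D        ∎)
        where open ≡-Reasoning

  nonzero⇒hasUnitValue : ∀ {a ℓ} (H : AbelianGroup a ℓ) (f : Hom H ℤ⁺) →
    ∀ h → ⟦ f ⟧ h ≢ 0ℤ → HasUnitValue H
  nonzero⇒hasUnitValue H f h fh≢0 with ⟦ f ⟧ h in fh≡
  ... | + zero   = contradiction ≡.refl fh≢0
  ... | + suc d  = positive⇒hasUnitValue H f d h fh≡
  ... | -[1+ d ] = positive⇒hasUnitValue H f d (AbelianGroup._⁻¹ H h)
    (≡.trans (⁻¹-homo f h) (cong ℤ.-_ fh≡))

  module _ {ℓ : Level} where
    private 𝐙 = Liftℤ ℓ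

    -- If all homomorphisms to the integers vanished, composition with morphisms from `H` could not
    -- tell the identity of the integers from zero, and separation would force 1 = 0.
    separator⇒hasUnitValue : (H : AbelianGroup ℓ ℓ) →
      Ab ℓ ⊨ separator 0F [ H ] → HasUnitValue H
    separator⇒hasUnitValue H sep with em {P = ∃₂ λ (f : Hom H ℤ⁺) h → ⟦ f ⟧ h ≢ 0ℤ}
    ... | yes (f , h , fh≢0) = nonzero⇒hasUnitValue H f h fh≢0
    ... | no ¬f = contradiction (lower (lower 1≈0 (lift 1ℤ))) λ ()
      where
      vanishes : (f : Hom H 𝐙) → ∀ h → lower (⟦ f ⟧ h) ≡ 0ℤ
      vanishes f h with lower (⟦ f ⟧ h) ℤ.≟ 0ℤ
      ... | yes fh≡0 = fh≡0
      ... | no  fh≢0 = contradiction (compose H 𝐙 ℤ⁺ (lowerHom ℓ) f , h , fh≢0) ¬f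

      1≈0 : Lift _ (∀ z → Lift ℓ (lower z ≡ 0ℤ))
      1≈0 = sep 𝐙 𝐙 (idHom 𝐙) (zeroHom 𝐙 𝐙) λ f → lift λ h → lift (vanishes f h)

    -- For a separator `H`, the unit value `h` defines the section and `g` the retraction.
    Liftℤ-integers : Ab ℓ ⊨ integers 0F [ 𝐙 ]
    Liftℤ-integers = infiniteCyclic⇒separator 𝐙 (Liftℤ-infiniteCyclic ℓ) , λ H sep →
      let (g , h , gh≡1) = separator⇒hasUnitValue H sep in
      point H h , compose H ℤ⁺ 𝐙 (liftHom ℓ) g , lift λ z → lift (begin
        ⟦ g ⟧ (Multiples._·_ H (lower z) h)  ≡⟨ ·-homo H ℤ⁺ g (lower z) h ⟩
        lower z · ⟦ g ⟧ h                    ≡⟨ cong (lower z ·_) gh≡1 ⟩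
        lower z · 1ℤ                         ≡⟨ hom-ℤ-· ℤ⁺ (idHom ℤ⁺) (lower z) ⟨
        lower z                              ∎)
      where
      open ≡-Reasoning
      open Multiples ℤ⁺
      open InfiniteCyclic (Liftℤ-infiniteCyclic ℓ) using (point)

-- The generator e is the image of 1 under the retraction.  Its coordinate is
-- idempotent, hence 0 or 1, and if it were 0 then Z would be trivial.
integers⇒infiniteCyclic : ∀ {ℓ} (Z : AbelianGroup ℓ ℓ) →
  Ab ℓ ⊨ integers 0F [ Z ] → InfiniteCyclic Z
integers⇒infiniteCyclic {ℓ} Z (sep , universal)
  -- The lifted integers are themselves a separator, so `Z` is a retract of them.
  with universal (Liftℤ ℓ) (infiniteCyclic⇒separator (Liftℤ ℓ) (Liftℤ-infiniteCyclic ℓ))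
... | s , r , lift r∘s≈id = record
  { generator      = e
  ; coordinate     = c
  ; coordinate-one = c[e]≡1
  ; generates      = generates
  }
  where
  open AbelianGroup Z
  open Multiples Z
  𝐙 = Liftℤ ℓ
  c = compose Z 𝐙 ℤ⁺ (lowerHom ℓ) s
  e = ⟦ r ⟧ (lift 1ℤ)

  generates : ∀ z → ⟦ c ⟧ z · e ≈ z
  generates z = begin
    ⟦ c ⟧ z · e             ≈⟨ hom-ℤ-· Z (compose ℤ⁺ 𝐙 Z r (liftHom ℓ)) (⟦ c ⟧ z) ⟨
    ⟦ r ⟧ (lift (⟦ c ⟧ z))  ≈⟨ r∘s≈id z ⟩
    z                       ∎
    where open ≈-Reasoning setoid

  c[e]*c[e]≡c[e] : ⟦ c ⟧ e ℤ.* ⟦ c ⟧ e ≡ ⟦ c ⟧ e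
  c[e]*c[e]≡c[e] = ≡.trans (≡.sym (·≡* (⟦ c ⟧ e) (⟦ c ⟧ e)))
    (≡.trans (≡.sym (·-homo Z ℤ⁺ c (⟦ c ⟧ e) e)) (⟦⟧-cong c (generates e)))

  c[e]≢0 : ⟦ c ⟧ e ≢ 0ℤ
  c[e]≢0 c[e]≡0 = contradiction (lower (lower 1≈0 (lift 1ℤ))) λ ()
    where
    e≈0 : e ≈ ε
    e≈0 = trans (sym (generates e)) (·-congˡ c[e]≡0)

    z≈0 : ∀ z → z ≈ ε
    z≈0 z = begin
      z            ≈⟨ generates z ⟨
      ⟦ c ⟧ z · e  ≈⟨ ·-congʳ (⟦ c ⟧ z) e≈0 ⟩
      ⟦ c ⟧ z · ε  ≈⟨ n·ε≈ε Z (⟦ c ⟧ z) ⟩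
      ε            ∎
      where open ≈-Reasoning setoid

    -- Every morphism out of a trivial `Z` is zero, so the separator `Z` would identify the identity
    -- of the integers with zero.
    1≈0 : Lift _ (∀ z → Lift ℓ (lower z ≡ 0ℤ))
    1≈0 = sep 𝐙 𝐙 (idHom 𝐙) (zeroHom 𝐙 𝐙) λ f → lift λ z →
      AbelianGroup.trans 𝐙 (⟦⟧-cong f (z≈0 z)) (ε-homo f)

  c[e]≡1 : ⟦ c ⟧ e ≡ 1ℤ
  c[e]≡1 = ℤ.*-cancelʳ-≡ _ _ (⟦ c ⟧ e) {{ℤ.≢-nonZero c[e]≢0}}
    (≡.trans c[e]*c[e]≡c[e] (≡.sym (ℤ.*-identityˡ _)))

-- Short exactness in terms of morphisms from an infinite cyclic group

module _ {ℓ} (Z E A : AbelianGroup ℓ ℓ) (cyc : InfiniteCyclic Z) where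
  private
    module Z where
      open AbelianGroup Z public
      open Multiples Z public
    module E where
      open AbelianGroup E public
      open Multiples E public
    module A where
      open AbelianGroup A public
      open Multiples A public
    open InfiniteCyclic cyc

  -- The environment is the one that `whitehead` builds up, so by computation this is its premise on
  -- `i` and `p`.
  SatisfiesShortExact : Hom Z E → Hom E A → Set _
  SatisfiesShortExact i p = Semantics.⟦_⟧ (Ab ℓ) (shortExact {Γ = []} 1F 0F 2F)
    (E Vector.∷ Z Vector.∷ A Vector.∷ Vector.[]) (p ∷ i ∷ [])

  -- This and `_∘coordinate` transport maps along the isomorphism of `Z` with the integers: the
  -- formula speaks of `Z`, whereas `IsWhitehead` uses the integers at level zero.
  _∘multiples : Hom Z E → Hom ℤ⁺ E
  i ∘multiples = compose ℤ⁺ Z E i (Z.multiples generator)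

  _∘coordinate : Hom ℤ⁺ E → Hom Z E
  i ∘coordinate = compose Z ℤ⁺ E i coordinate

  satisfiesShortExact⇒isShortExact : (i : Hom Z E) (p : Hom E A) →
    SatisfiesShortExact i p → IsShortExact {K = ℤ⁺} {E} {A} (i ∘multiples) p
  satisfiesShortExact⇒isShortExact i p (mono , zero∘ , kernel , epi) = record
    { injective  = injective
    ; exact      = λ x → mk⇔ (ker⊆im x) λ (k , ik≈x) →
        A.trans (⟦⟧-cong p (E.sym ik≈x)) (p∘i≈0 _)
    ; surjective = surjective
    }
    where
    injective : ∀ {m n} →
      ⟦ i ⟧ (m Z.· generator) E.≈ ⟦ i ⟧ (n Z.· generator) → m ≡ n
    injective {m} {n} im≈in = ≡.trans (≡.sym (coordinate-· m))
      (≡.trans (⟦⟧-cong coordinate mg≈ng) (coordinate-· n))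
      where
      -- Multiplication by `k` is the endomorphism that stands for the integer `k`, so that `mono`
      -- can compare `m` with `n`.
      scale : ℤ → Hom Z Z
      scale k = point Z (k Z.· generator)

      i∘scale : ∀ k z →
        ⟦ i ⟧ (⟦ scale k ⟧ z) E.≈ ⟦ coordinate ⟧ z E.· ⟦ i ⟧ (k Z.· generator)
      i∘scale k z = ·-homo Z E i (⟦ coordinate ⟧ z) (k Z.· generator)

      scale-m≈scale-n : ∀ z → ⟦ scale m ⟧ z Z.≈ ⟦ scale n ⟧ z
      scale-m≈scale-n = lower (mono (scale m) (scale n) (lift λ z → begin
        ⟦ i ⟧ (⟦ scale m ⟧ z)                               ≈⟨ i∘scale m z ⟩
        ⟦ coordinate ⟧ z E.· ⟦ i ⟧ (m Z.· generator)        ≈⟨ E.·-congʳ (⟦ coordinate ⟧ z) im≈in ⟩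
        ⟦ coordinate ⟧ z E.· ⟦ i ⟧ (n Z.· generator)        ≈⟨ i∘scale n z ⟨
        ⟦ i ⟧ (⟦ scale n ⟧ z)                               ∎))
        where open ≈-Reasoning E.setoid

      mg≈ng : m Z.· generator Z.≈ n Z.· generator
      mg≈ng = Z.trans (Z.sym (point-generator Z _))
        (Z.trans (scale-m≈scale-n generator) (point-generator Z _))

    p∘i≈0 : ∀ z → ⟦ p ⟧ (⟦ i ⟧ z) A.≈ A.ε
    -- Comparing the identity with the zero endomorphism turns constancy into vanishing.
    p∘i≈0 z = A.trans (lower (zero∘ (idHom Z) (zeroHom Z Z)) z)
      (A.trans (⟦⟧-cong p (ε-homo i)) (ε-homo p))

    p∘point≈0 : ∀ {x} → ⟦ p ⟧ x A.≈ A.ε → ∀ z → ⟦ p ⟧ (⟦ point E x ⟧ z) A.≈ A.ε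
    p∘point≈0 {x} px≈0 z = A.trans (·-homo E A p (⟦ coordinate ⟧ z) x)
      (A.trans (A.·-congʳ (⟦ coordinate ⟧ z) px≈0) (n·ε≈ε A (⟦ coordinate ⟧ z)))

    ker⊆im : ∀ x → ⟦ p ⟧ x A.≈ A.ε → ∃ λ n → ⟦ i ⟧ (n Z.· generator) E.≈ x
    -- Both composites vanish, as `p` kills every multiple of `x`. The integer sought is the
    -- coordinate of `k` at the generator.
    ker⊆im x px≈0 with kernel (point E x) (λ u v → lift λ z →
        A.trans (p∘point≈0 px≈0 (⟦ u ⟧ z)) (A.sym (p∘point≈0 px≈0 (⟦ v ⟧ z))))
    ... | k , lift i∘k≈x = ⟦ coordinate ⟧ (⟦ k ⟧ generator) , (begin
      ⟦ i ⟧ (⟦ coordinate ⟧ (⟦ k ⟧ generator) Z.· generator) ≈⟨ ⟦⟧-cong i (generates _) ⟩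
      ⟦ i ⟧ (⟦ k ⟧ generator)                                ≈⟨ i∘k≈x generator ⟩
      ⟦ point E x ⟧ generator                                ≈⟨ point-generator E x ⟩
      x                                                      ∎)
      where open ≈-Reasoning E.setoid

    surjective : ∀ y → ∃ λ x → ∀ {x′} → x′ E.≈ x → ⟦ p ⟧ x′ A.≈ y
    surjective y with epi (point A y)
    ... | x , lift p∘x≈y = ⟦ x ⟧ generator , λ x′≈x →
      A.trans (⟦⟧-cong p x′≈x) (A.trans (p∘x≈y generator) (point-generator A y))

  isShortExact⇒satisfiesShortExact : (i : Hom ℤ⁺ E) (p : Hom E A) →
    IsShortExact {K = ℤ⁺} {E} {A} i p → SatisfiesShortExact (i ∘coordinate) p
  isShortExact⇒satisfiesShortExact i p ses =
      (λ u v iu≈iv → lift λ z → coordinate-injective (injective (lower iu≈iv z)))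
    , (λ u v → lift λ z → A.trans (p∘i≈0 _) (A.sym (p∘i≈0 _)))
    , kernel
    -- A preimage of the one value at the generator extends to all of `Z` by freeness.
    , λ y → let (x , px≈y) = surjective (⟦ y ⟧ generator) in
        point E x , lift λ z → A.trans (·-homo E A p (⟦ coordinate ⟧ z) x)
          (A.trans (A.·-congʳ (⟦ coordinate ⟧ z) (px≈y E.refl)) (A.sym (hom-· A y z)))
    where
    open IsShortExact ses

    p∘i≈0 : ∀ n → ⟦ p ⟧ (⟦ i ⟧ n) A.≈ A.ε
    p∘i≈0 n = Equivalence.from (exact _) (n , E.refl)

    kernel : (x : Hom Z E) →
      ((u v : Hom Z Z) →
        Lift _ (∀ z → ⟦ p ⟧ (⟦ x ⟧ (⟦ u ⟧ z)) A.≈ ⟦ p ⟧ (⟦ x ⟧ (⟦ v ⟧ z)))) →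
      ∃ λ (k : Hom Z Z) →
        Lift _ (∀ z → ⟦ i ⟧ (⟦ coordinate ⟧ (⟦ k ⟧ z)) E.≈ ⟦ x ⟧ z)
    kernel x p∘x-constant with Equivalence.to (exact (⟦ x ⟧ generator))
      (A.trans (lower (p∘x-constant (idHom Z) (zeroHom Z Z)) generator)
        (A.trans (⟦⟧-cong p (ε-homo x)) (ε-homo p)))
    ... | n , in≈x = k , lift λ z → begin
      ⟦ i∘k ⟧ z                               ≈⟨ hom-· E i∘k z ⟩
      ⟦ coordinate ⟧ z E.· ⟦ i∘k ⟧ generator  ≈⟨ E.·-congʳ (⟦ coordinate ⟧ z) i∘k≈x ⟩
      ⟦ coordinate ⟧ z E.· ⟦ x ⟧ generator    ≈⟨ hom-· E x z ⟨
      ⟦ x ⟧ z                                 ∎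
      where
      open ≈-Reasoning E.setoid
      -- Two homomorphisms from `Z` agree once they agree at the generator, so `k` need only have
      -- the right value there.
      k = point Z (n Z.· generator)
      i∘k = compose Z Z E (i ∘coordinate) k

      i∘k≈x : ⟦ i∘k ⟧ generator E.≈ ⟦ x ⟧ generator
      i∘k≈x = begin
        ⟦ i∘k ⟧ generator                         ≈⟨ ⟦⟧-cong (i ∘coordinate) (point-generator Z _) ⟩
        ⟦ i ⟧ (⟦ coordinate ⟧ (n Z.· generator))  ≈⟨ ⟦⟧-cong i (coordinate-· n) ⟩
        ⟦ i ⟧ n                                   ≈⟨ in≈x ⟩
        ⟦ x ⟧ generator                           ∎

-- Correctness of the formula

whitehead⇒isWhitehead : (∀ {a} → ExcludedMiddle a) →
  ∀ {ℓ} (A : AbelianGroup ℓ ℓ) → Ab ℓ ⊨ whitehead [ A ] → IsWhitehead A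
whitehead⇒isWhitehead em {ℓ} A satisfied E i p ses
  -- Excluded middle shows that the lifted integers satisfy `integers`, so they may serve as the
  -- bound object.
  with satisfied (Liftℤ ℓ) (Liftℤ-integers em)
    E (_∘coordinate (Liftℤ ℓ) E A (Liftℤ-infiniteCyclic ℓ) i) p
    (isShortExact⇒satisfiesShortExact (Liftℤ ℓ) E A (Liftℤ-infiniteCyclic ℓ) i p ses)
... | s , lift p∘s≈id = s , p∘s≈id

-- The bound object is infinite cyclic, so its map into `E` becomes a map from the integers with the
-- same image. Splitting concerns `p` alone, and the section carries over unchanged.
isWhitehead⇒whitehead : ∀ {ℓ} (A : AbelianGroup ℓ ℓ) →
  IsWhitehead A → Ab ℓ ⊨ whitehead [ A ]
isWhitehead⇒whitehead A isWhitehead Z isIntegers E i p ses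
  with cyc ← integers⇒infiniteCyclic Z isIntegers
  with isWhitehead E (_∘multiples Z E A cyc i) p
    (satisfiesShortExact⇒isShortExact Z E A cyc i p ses)
... | s , p∘s≈id = s , lift p∘s≈id

proposition10p3 : Σω ObjectFormula λ φ →
    (∀ {a} → ExcludedMiddle a) →
    ∀ {ℓ} (A : AbelianGroup ℓ ℓ) →
    (Ab ℓ ⊨ φ [ A ]) ⇔ IsWhitehead A
proposition10p3 = whitehead ,ω λ em A →
  mk⇔ (whitehead⇒isWhitehead em A) (isWhitehead⇒whitehead A)
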